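{- Let $\{\sigma_i\}_{i\in I}$ be a family of contiguous patterns. In (i) and (ii), for each $i\in I$ let $k_i$ be an integer greater than all letters of $\sigma_i$; in (iii) and (iv), assume that all letters of every $\sigma_i$ are greater than $1$. Let $n\ge 1$ and $\pi\in\mathcal{S}_n$. Write $\pi=\pi_{\ell}\,n\,\pi_r$, where $\pi_\ell$ and $\pi_r$ are the parts of $\pi$ to the left and to the right of the letter $n$, and $\pi=\widehat{\pi}_{\ell}\,1\,\widehat{\pi}_r$, where $\widehat{\pi}_\ell$ and $\widehat{\pi}_r$ are the parts of $\pi$ to the left and to the right of the letter $1$. Then: (i) $\pi$ avoids all the patterns $k_i$-$\sigma_i$ ($i\in I$) if and only if $\pi_\ell$ avoids all the patterns $k_i$-$\sigma_i$ ($i\in I$) and $\pi_r$ avoids all the patterns $\sigma_i$ ($i\in I$). (ii) $\pi$ avoids all the patterns $\sigma_i$-$k_i$ ($i\in I$) if and only if $\pi_\ell$ avoids all the patterns $\sigma_i$ ($i\in I$) and $\pi_r$ avoids all the patterns $\sigma_i$-$k_i$ ($i\in I$). (iii) $\pi$ avoids all the patterns $1$-$\sigma_i$ ($i\in I$) if and only if $\widehat{\pi}_\ell$ avoids all the patterns $1$-$\sigma_i$ ($i\in I$) and $\widehat{\pi}_r$ avoids all the patterns $\sigma_i$ ($i\in I$). (iv) $\pi$ avoids all the patterns $\sigma_i$-$1$ ($i\in I$) if and only if $\widehat{\pi}_\ell$ avoids all the patterns $\sigma_i$ ($i\in I$) and $\widehat{\pi}_r$ avoids all the patterns $\sigma_i$-$1$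 ($i\in I$).
   Context: $\mathcal{S}_n$ is the set of permutations of $[n]=\{1,\dots,n\}$, written as words. A (partially ordered generalized) pattern is a nonempty word $p_1p_2\dots p_m$ of positive integers (repetitions allowed) with a dash written between some of the consecutive letters; it is contiguous if it has no dashes. An occurrence of it in a word $w=a_1\dots a_N$ of distinct integers (in particular in a permutation or a factor of a permutation) is a subsequence $a_{j_1}a_{j_2}\dots a_{j_m}$, $j_1<\dots<j_m$, such that (a) $p_s>p_t$ implies $a_{j_s}>a_{j_t}$ for all $s,t$ (no condition when $p_s=p_t$), and (b) $j_{s+1}=j_s+1$ whenever $p_s$ and $p_{s+1}$ are not separated by a dash. $w$ avoids the pattern if it has no occurrence of it. The notation $k$-$\sigma$ means the letter $k$, then a dash, then $\sigma$; similarly for $\sigma$-$k$. -}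

module Defs where

open import Data.Nat.Base using (ℕ; suc; _<_; _>_; NonZero; >-nonZero⁻¹)
open import Data.Fin.Base as Fin using (Fin; toℕ; inject₁)
open import Data.List.Base as List using (List; length; applyUpTo)
open import Data.List.Relation.Binary.Permutation.Propositional using (_↭_)
open import Data.Vec.Base as Vec using (Vec; _∷_; _∷ʳ_)
open import Data.Vec.Relation.Unary.All using (All; []; _∷_)
open import Relation.Binary.PropositionalEquality using (_≡_)
open import Relation.Nullary.Negation using (¬_)

Word : Set
Word = List ℕ

_∈𝒮_ : Word → ℕ → Set
π ∈𝒮 n = π ↭ applyUpTo suc n

data Link : Set where
  adjacent dash : Link

-- `lookup links s` tells whether letters s and s + 1 are separated by a dash.
record Pattern : Set where
  field
    {size}   : ℕ
    letters  : Vec ℕ (suc size)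
    positive : All (_> 0) letters
    links    : Vec Link size

open Pattern public using (letters; links)

Contiguous : Pattern → Set
Contiguous p = All (_≡ adjacent) (links p)

record Occurrence (p : Pattern) (w : Word) : Set where
  open Pattern p using (size)
  field
    position   : Fin (suc size) → Fin (length w)
    increasing : ∀ s t → s Fin.< t → position s Fin.< position t
    order      : ∀ s t → Vec.lookup (letters p) s > Vec.lookup (letters p) t →
                 List.lookup w (position s) > List.lookup w (position t)
    contiguity : ∀ (s : Fin size) → Vec.lookup (links p) s ≡ adjacent →
                 toℕ (position (Fin.suc s)) ≡ suc (toℕ (position (inject₁ s)))

_Avoids_ : Word → Pattern → Set
w Avoids p = ¬ Occurrence p w

private
  ∷ʳ⁺ : ∀ {n k} {xs : Vec ℕ n} → All (_> 0) xs → k > 0 → All (_> 0) (xs ∷ʳ k)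
  ∷ʳ⁺ []         k>0 = k>0 ∷ []
  ∷ʳ⁺ (x>0 ∷ xs) k>0 = x>0 ∷ ∷ʳ⁺ xs k>0

infixr 6 _-ˡ_
infixl 6 _-ʳ_

-- k -ˡ σ is the pattern k-σ, and σ -ʳ k is the pattern σ-k.
_-ˡ_ : (k : ℕ) .{{_ : NonZero k}} → Pattern → Pattern
k -ˡ σ = record
  { letters  = k ∷ letters σ
  ; positive = >-nonZero⁻¹ k ∷ Pattern.positive σ
  ; links    = dash ∷ links σ
  }

_-ʳ_ : Pattern → (k : ℕ) .{{_ : NonZero k}} → Pattern
σ -ʳ k = record
  { letters  = letters σ ∷ʳ k
  ; positive = ∷ʳ⁺ (Pattern.positive σ) (>-nonZero⁻¹ k)
  ; links    = links σ ∷ʳ dash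
  }

_AvoidsAll_ : ∀ {ℓ} {I : Set ℓ} → Word → (I → Pattern) → Set ℓ
w AvoidsAll σ = ∀ i → w Avoids σ i

infix 4 _∈𝒮_ _Avoids_ _AvoidsAll_

{-# OPTIONS --safe #-}
module Submission where

-- Since σ is contiguous, the positions of an occurrence of σ form an interval, so
-- the occurrence lies to the left of the extreme letter of π, or to its right, or
-- uses it.  When k is compared with all letters of σ as the extreme letter is with
-- the rest of π, an occurrence of k-σ or σ-k cannot use the extreme letter in its
-- σ-part, and conversely the extreme letter can play k for any occurrence of σ on
-- the appropriate side.

open import Data.Empty using (⊥)
open import Data.Fin.Base as Fin using (Fin; zero; suc; toℕ; fromℕ; inject₁)
open import Data.Fin.Induction using (<-weakInduction)
import Data.Fin.Properties as Fin
open import Data.Fin.Relation.Unary.Top using (view; ‵fromℕ; ‵inject₁)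
open import Data.List.Base using (_++_; _∷_; []; length; lookup)
open import Data.List.Membership.Propositional.Properties using (∈-lookup)
open import Data.List.Relation.Binary.Permutation.Propositional using (↭-sym; ↭⇒↭ₛ)
open import Data.List.Relation.Binary.Permutation.Propositional.Properties using (All-resp-↭)
import Data.List.Relation.Binary.Permutation.Setoid.Properties as Permutationₛ
import Data.List.Relation.Unary.All as List
import Data.List.Relation.Unary.All.Properties as List
open import Data.List.Relation.Unary.AllPairs using (_∷_)
open import Data.List.Relation.Unary.Unique.Propositional using (Unique)
import Data.List.Relation.Unary.Unique.Propositional.Properties as Unique
open import Data.Nat.Base using (ℕ; suc; _+_; _<_; _>_; _≤_; NonZero; z<s; s<s; s<s⁻¹)
open import Data.Nat.Properties
open import Data.Product.Base using (_×_; _,_; proj₁; proj₂; ∃)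
open import Data.Sum.Base using (_⊎_; inj₁; inj₂)
open import Data.Vec.Base as Vec using (Vec; _∷ʳ_)
open import Data.Vec.Properties using (lookup∘tabulate)
open import Data.Vec.Relation.Unary.All using (All)
import Data.Vec.Relation.Unary.All.Properties as Vec
open import Function.Base using (_∘_)
open import Function.Bundles using (_⇔_; mk⇔)
open import Relation.Binary.Definitions using (tri<; tri≈; tri>)
open import Relation.Binary.PropositionalEquality
open import Relation.Nullary.Decidable using (yes; no)
open import Relation.Nullary.Negation using (contradiction)
open import Defs
open Occurrence

private variable
  A : Set
  p : Pattern
  u w : Word

-- Entries of extended vectors and of words with distinct letters.

lookup-∷ʳ-inject₁ : ∀ {n} (xs : Vec A n) x i → Vec.lookup (xs ∷ʳ x) (inject₁ i) ≡ Vec.lookup xs i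
lookup-∷ʳ-inject₁ (y Vec.∷ xs) x zero    = refl
lookup-∷ʳ-inject₁ (y Vec.∷ xs) x (suc i) = lookup-∷ʳ-inject₁ xs x i

lookup-∷ʳ-fromℕ : ∀ {n} (xs : Vec A n) x → Vec.lookup (xs ∷ʳ x) (fromℕ n) ≡ x
lookup-∷ʳ-fromℕ Vec.[]       x = refl
lookup-∷ʳ-fromℕ (y Vec.∷ xs) x = lookup-∷ʳ-fromℕ xs x

lookup-injective : Unique w → ∀ i j → lookup w i ≡ lookup w j → i ≡ j
lookup-injective (_  ∷ _)  zero    zero    _  = refl
lookup-injective (x≢ ∷ _)  zero    (suc j) eq = contradiction eq (List.lookup x≢ (∈-lookup j))
lookup-injective (x≢ ∷ _)  (suc i) zero    eq = contradiction (sym eq) (List.lookup x≢ (∈-lookup i))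
lookup-injective (_  ∷ xs) (suc i) (suc j) eq = cong suc (lookup-injective xs i j eq)

-- Transport of occurrences between a word and its factors.

-- Offsets on both sides, so that one relation covers embedding and restriction without subtraction.
record Aligned (c d : ℕ) (u w : Word) (i : Fin (length u)) (j : Fin (length w)) : Set where
  constructor aligned
  field
    shift  : c + toℕ i ≡ d + toℕ j
    letter : lookup u i ≡ lookup w j

open Aligned

-- The offsets are the same for every `s`, so all positions are translated by one common amount,
-- which keeps both their order and their adjacency; the comparisons survive because the letters
-- themselves do not change.
relocate : ∀ c d (o : Occurrence p u) → (∀ s → ∃ (Aligned c d u w (position o s))) → Occurrence p w
relocate c d o f = record
  { position   = proj₁ ∘ f
  ; increasing = λ s t s<t → +-cancelˡ-< d _ _
      (subst₂ _<_ (shift (proj₂ (f s))) (shift (proj₂ (f t))) (+-monoʳ-< c (increasing o s t s<t)))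
  ; order      = λ s t s>t → subst₂ _>_ (letter (proj₂ (f s))) (letter (proj₂ (f t))) (order o s t s>t)
  ; contiguity = λ s adj → +-cancelˡ-≡ d _ _
      (begin
        d + toℕ (proj₁ (f (suc s)))           ≡⟨ shift (proj₂ (f (suc s))) ⟨
        c + toℕ (position o (suc s))          ≡⟨ cong (c +_) (contiguity o s adj) ⟩
        c + suc (toℕ (position o (inject₁ s))) ≡⟨ +-suc c _ ⟩
        suc (c + toℕ (position o (inject₁ s))) ≡⟨ cong suc (shift (proj₂ (f (inject₁ s)))) ⟩
        suc (d + toℕ (proj₁ (f (inject₁ s)))) ≡⟨ +-suc d _ ⟨
        d + suc (toℕ (proj₁ (f (inject₁ s)))) ∎)
  }
  where open ≡-Reasoning

-- Recursion on `xs` places the index in `Fin (length (xs ++ a ∷ ys))` directly, with no cast along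
-- the length of an append.
pivot : ∀ (xs : Word) a ys → Fin (length (xs ++ a ∷ ys))
pivot []       a ys = zero
pivot (x ∷ xs) a ys = suc (pivot xs a ys)

lookup-pivot : ∀ (xs : Word) a ys → lookup (xs ++ a ∷ ys) (pivot xs a ys) ≡ a
lookup-pivot []       a ys = refl
lookup-pivot (x ∷ xs) a ys = lookup-pivot xs a ys

-- The comparison with `pivot` is recorded because the pivot letter is later attached to an embedded
-- occurrence in the role of `k`.
before : ∀ (xs : Word) a ys i → ∃ λ j → Aligned 0 0 xs (xs ++ a ∷ ys) i j × j Fin.< pivot xs a ys
before (x ∷ xs) a ys zero    = zero , aligned refl refl , z<s
before (x ∷ xs) a ys (suc i) with before xs a ys i
... | j , aligned eq eq′ , j< = suc j , aligned (cong suc eq) eq′ , s<s j<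

before⁻¹ : ∀ (xs : Word) a ys j → j Fin.< pivot xs a ys → ∃ (Aligned 0 0 (xs ++ a ∷ ys) xs j)
before⁻¹ (x ∷ xs) a ys zero    _  = zero , aligned refl refl
before⁻¹ (x ∷ xs) a ys (suc j) j< with before⁻¹ xs a ys j (s<s⁻¹ j<)
... | i , aligned eq eq′ = suc i , aligned (cong suc eq) eq′

-- The offset counts the letters of `xs` together with `a`.
after : ∀ (xs : Word) a ys i →
        ∃ λ j → Aligned (suc (length xs)) 0 ys (xs ++ a ∷ ys) i j × pivot xs a ys Fin.< j
after []       a ys i = suc i , aligned refl refl , z<s
after (x ∷ xs) a ys i with after xs a ys i
... | j , aligned eq eq′ , <j = suc j , aligned (cong suc eq) eq′ , s<s <j

after⁻¹ : ∀ (xs : Word) a ys j → pivot xs a ys Fin.< j →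
          ∃ (Aligned 0 (suc (length xs)) (xs ++ a ∷ ys) ys j)
after⁻¹ []       a ys (suc j) _  = j , aligned refl refl
after⁻¹ (x ∷ xs) a ys (suc j) <j with after⁻¹ xs a ys j (s<s⁻¹ <j)
... | i , aligned eq eq′ = i , aligned (cong suc eq) eq′

module _ (xs : Word) (a : ℕ) (ys : Word) where

  embedˡ : Occurrence p xs → Occurrence p (xs ++ a ∷ ys)
  embedˡ o = relocate 0 0 o λ s → let j , al , _ = before xs a ys (position o s) in j , al

  embedʳ : Occurrence p ys → Occurrence p (xs ++ a ∷ ys)
  embedʳ o = relocate (suc (length xs)) 0 o λ s → let j , al , _ = after xs a ys (position o s) in j , al

  restrictˡ : (o : Occurrence p (xs ++ a ∷ ys)) → (∀ s → position o s Fin.< pivot xs a ys) → Occurrence p xs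
  restrictˡ o o<m = relocate 0 0 o λ s → before⁻¹ xs a ys (position o s) (o<m s)

  restrictʳ : (o : Occurrence p (xs ++ a ∷ ys)) → (∀ s → pivot xs a ys Fin.< position o s) → Occurrence p ys
  restrictʳ o m<o = relocate 0 (suc (length xs)) o λ s → after⁻¹ xs a ys (position o s) (m<o s)

-- Contiguous occurrences relative to an extreme letter.

-- Positions of a contiguous occurrence advance by exactly one, so they cannot pass `m` without
-- hitting it. If `m` is missed, the side of the first position propagates to all the others.
contiguous-trichotomy : Contiguous p → (o : Occurrence p w) (m : Fin (length w)) →
  (∀ s → position o s Fin.< m) ⊎ (∃ λ s → position o s ≡ m) ⊎ (∀ s → m Fin.< position o s)
contiguous-trichotomy c o m with Fin.any? (λ s → position o s Fin.≟ m)
... | yes hit = inj₂ (inj₁ hit)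
... | no miss with Fin.<-cmp (position o zero) m
...   | tri≈ _ eq _ = contradiction (zero , eq) miss
-- Contiguity turns `os<m` into a weak bound on the next position, and `miss` makes it strict.
...   | tri< o₀<m _ _ = inj₁ (<-weakInduction (λ s → position o s Fin.< m) o₀<m λ s os<m →
          Fin.≤∧≢⇒< (subst (_≤ toℕ m) (sym (contiguity o s (Vec.lookup⁺ c s))) os<m)
                    (miss ∘ (suc s ,_)))
...   | tri> _ _ m<o₀ = inj₂ (inj₂ (<-weakInduction (λ s → m Fin.< position o s) m<o₀ λ s m<os →
          subst (toℕ m <_) (sym (contiguity o s (Vec.lookup⁺ c s))) (m<n⇒m<1+n m<os)))

-- k compares with all letters of p as the letter of w at m does with the rest of w.
Extreme : ℕ → Pattern → (w : Word) → Fin (length w) → Set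
Extreme k p w m =
  ∀ s → (k > Vec.lookup (letters p) s × ∀ j → j ≢ m → lookup w m > lookup w j)
      ⊎ (Vec.lookup (letters p) s > k × ∀ j → j ≢ m → lookup w j > lookup w m)

module _ {k : ℕ} (p : Pattern) (w : Word) {m : Fin (length w)} (ext : Extreme k p w m) where

  extreme-> : ∀ s j → j ≢ m → k > Vec.lookup (letters p) s → lookup w m > lookup w j
  extreme-> s j j≢m k>s with ext s
  ... | inj₁ (_ , top)   = top j j≢m
  ... | inj₂ (s>k , _) = contradiction k>s (<-asym s>k)

  extreme-< : ∀ s j → j ≢ m → Vec.lookup (letters p) s > k → lookup w j > lookup w m
  extreme-< s j j≢m s>k with ext s
  ... | inj₁ (k>s , _)    = contradiction s>k (<-asym k>s)
  ... | inj₂ (_ , bottom) = bottom j j≢m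

  -- If `m` plays the letter `s` and `j` plays `k`, then `f` and `g` are the order conditions
  -- between them. They place the letter at `j` beyond the one at `m`, on the very side where the
  -- latter is extreme.
  extreme-unused : ∀ s j → j ≢ m →
    (k > Vec.lookup (letters p) s → lookup w j > lookup w m) →
    (Vec.lookup (letters p) s > k → lookup w m > lookup w j) → ⊥
  extreme-unused s j j≢m f g with ext s
  ... | inj₁ (k>s , top)    = <-asym (top j j≢m) (f k>s)
  ... | inj₂ (s>k , bottom) = <-asym (bottom j j≢m) (g s>k)

-- Removing and attaching the letter `k`.

module _ {k : ℕ} .{{_ : NonZero k}} {p : Pattern} {w : Word} where

  -ˡ-tail : Occurrence (k -ˡ p) w → Occurrence p w
  -ˡ-tail o = record
    { position   = position o ∘ suc
    ; increasing = λ s t s<t → increasing o (suc s) (suc t) (s<s s<t)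
    ; order      = λ s t → order o (suc s) (suc t)
    ; contiguity = λ s → contiguity o (suc s)
    }

  -ʳ-init : Occurrence (p -ʳ k) w → Occurrence p w
  -ʳ-init o = record
    { position   = position o ∘ inject₁
    ; increasing = λ s t s<t → increasing o (inject₁ s) (inject₁ t)
        (subst₂ _<_ (sym (Fin.toℕ-inject₁ s)) (sym (Fin.toℕ-inject₁ t)) s<t)
    ; order      = λ s t s>t → order o (inject₁ s) (inject₁ t)
        (subst₂ _>_ (sym (lookup-∷ʳ-inject₁ (letters p) k s)) (sym (lookup-∷ʳ-inject₁ (letters p) k t)) s>t)
    ; contiguity = λ s adj → contiguity o (inject₁ s) (trans (lookup-∷ʳ-inject₁ (links p) dash s) adj)
    }

  -- The dash after `k` leaves the distance from `m` to the rest free, and extremality supplies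
  -- every comparison that involves `k`.
  -ˡ-cons : (o : Occurrence p w) (m : Fin (length w)) → (∀ s → m Fin.< position o s) →
            Extreme k p w m → Occurrence (k -ˡ p) w
  -ˡ-cons o m m<o ext = record
    { position   = pos
    ; increasing = inc
    ; order      = ord
    ; contiguity = λ { zero () ; (suc s) → contiguity o s }
    }
    where
    pos : Fin _ → Fin (length w)
    pos zero    = m
    pos (suc s) = position o s

    o≢m : ∀ s → position o s ≢ m
    o≢m s = ≢-sym (Fin.<⇒≢ (m<o s))

    inc : ∀ s t → s Fin.< t → pos s Fin.< pos t
    inc zero    (suc t) _   = m<o t
    inc (suc s) (suc t) s<t = increasing o s t (s<s⁻¹ s<t)

    ord : ∀ s t → Vec.lookup (letters (k -ˡ p)) s > Vec.lookup (letters (k -ˡ p)) t →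
          lookup w (pos s) > lookup w (pos t)
    ord zero    zero    k>k = contradiction k>k (<-irrefl refl)
    ord zero    (suc t) k>t = extreme-> p w ext t (position o t) (o≢m t) k>t
    ord (suc s) zero    s>k = extreme-< p w ext s (position o s) (o≢m s) s>k
    ord (suc s) (suc t) s>t = order o s t s>t

  -ʳ-snoc : (o : Occurrence p w) (m : Fin (length w)) → (∀ s → position o s Fin.< m) →
            Extreme k p w m → Occurrence (p -ʳ k) w
  -ʳ-snoc o m o<m ext = record
    { position   = pos
    ; increasing = inc
    ; order      = ord
    ; contiguity = con
    }
    where
    open Pattern p using (size)

    -- Positions are read from a vector extended by `∷ʳ`, just as the letters and links of `p -ʳ k`
    -- are, so the same two lookup lemmas serve all three.
    pos : Fin (suc (suc size)) → Fin (length w)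
    pos = Vec.lookup (Vec.tabulate (position o) ∷ʳ m)

    pos-init : ∀ s → pos (inject₁ s) ≡ position o s
    pos-init s = trans (lookup-∷ʳ-inject₁ (Vec.tabulate (position o)) m s) (lookup∘tabulate (position o) s)

    pos-last : pos (fromℕ (suc size)) ≡ m
    pos-last = lookup-∷ʳ-fromℕ (Vec.tabulate (position o)) m

    o≢m : ∀ s → position o s ≢ m
    o≢m s = Fin.<⇒≢ (o<m s)

    inc : ∀ s t → s Fin.< t → pos s Fin.< pos t
    inc s t s<t with view s | view t
    ... | ‵fromℕ    | _ = contradiction (Fin.≤fromℕ t) (<⇒≱ s<t)
    ... | ‵inject₁ s | ‵fromℕ rewrite pos-init s | pos-last = o<m s
    ... | ‵inject₁ s | ‵inject₁ t rewrite pos-init s | pos-init t =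
      increasing o s t (subst₂ _<_ (Fin.toℕ-inject₁ s) (Fin.toℕ-inject₁ t) s<t)

    ord : ∀ s t → Vec.lookup (letters (p -ʳ k)) s > Vec.lookup (letters (p -ʳ k)) t →
          lookup w (pos s) > lookup w (pos t)
    ord s t s>t with view s | view t
    ... | ‵fromℕ | ‵fromℕ = contradiction s>t (<-irrefl refl)
    ... | ‵fromℕ | ‵inject₁ t
      rewrite pos-last | pos-init t | lookup-∷ʳ-fromℕ (letters p) k | lookup-∷ʳ-inject₁ (letters p) k t =
      extreme-> p w ext t (position o t) (o≢m t) s>t
    ... | ‵inject₁ s | ‵fromℕ
      rewrite pos-last | pos-init s | lookup-∷ʳ-fromℕ (letters p) k | lookup-∷ʳ-inject₁ (letters p) k s =
      extreme-< p w ext s (position o s) (o≢m s) s>t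
    ... | ‵inject₁ s | ‵inject₁ t
      rewrite pos-init s | pos-init t | lookup-∷ʳ-inject₁ (letters p) k s | lookup-∷ʳ-inject₁ (letters p) k t =
      order o s t s>t

    con : ∀ s → Vec.lookup (links (p -ʳ k)) s ≡ adjacent → toℕ (pos (suc s)) ≡ suc (toℕ (pos (inject₁ s)))
    con s adj with view s
    -- This is the link between the last letter of `p` and `k`; it is a dash, so `adj` is absurd.
    ... | ‵fromℕ with () ← trans (sym (lookup-∷ʳ-fromℕ (links p) dash)) adj
    -- The first rewrite applies because `suc (inject₁ s)` and `inject₁ (suc s)` agree by
    -- computation.
    ... | ‵inject₁ s rewrite pos-init (suc s) | pos-init (inject₁ s) =
      contiguity o s (trans (sym (lookup-∷ʳ-inject₁ (links p) dash s)) adj)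

-- A single pattern and a word split at its extreme letter.

module _ (k : ℕ) .{{_ : NonZero k}} (p : Pattern) (c : Contiguous p) (xs : Word) (a : ℕ) (ys : Word)
         (ext : Extreme k p (xs ++ a ∷ ys) (pivot xs a ys)) where

  private
    π = xs ++ a ∷ ys
    m = pivot xs a ys

  avoids-ˡ : xs ++ a ∷ ys Avoids k -ˡ p ⇔ (xs Avoids k -ˡ p × ys Avoids p)
  avoids-ˡ = mk⇔
    (λ av → av ∘ embedˡ xs a ys ,
            λ o → av (-ˡ-cons (embedʳ xs a ys o) m (λ s → proj₂ (proj₂ (after xs a ys (position o s)))) ext))
    from
    where
    from : xs Avoids k -ˡ p × ys Avoids p → xs ++ a ∷ ys Avoids k -ˡ p
    from (avˡ , avʳ) o with contiguous-trichotomy c (-ˡ-tail o) m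
    ... | inj₁ o<m = avˡ (restrictˡ xs a ys o λ where
            -- The letter playing `k` precedes the `p`-part, hence it also lies left of the pivot.
            zero    → Fin.<-trans (increasing o zero (suc zero) z<s) (o<m zero)
            (suc s) → o<m s)
    ... | inj₂ (inj₂ m<o) = avʳ (restrictʳ xs a ys (-ˡ-tail o) m<o)
    -- The pivot would play a letter of `p`, while another position plays `k`.
    ... | inj₂ (inj₁ (s , o≡m)) = extreme-unused p π ext s (position o zero)
            (λ eq → Fin.<⇒≢ (increasing o zero (suc s) z<s) (trans eq (sym o≡m)))
            (λ k>s → subst (λ j → lookup π (position o zero) > lookup π j) o≡m (order o zero (suc s) k>s))
            (λ s>k → subst (λ j → lookup π j > lookup π (position o zero)) o≡m (order o (suc s) zero s>k))

  avoids-ʳ : xs ++ a ∷ ys Avoids p -ʳ k ⇔ (xs Avoids p × ys Avoids p -ʳ k)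
  avoids-ʳ = mk⇔
    (λ av → (λ o → av (-ʳ-snoc (embedˡ xs a ys o) m (λ s → proj₂ (proj₂ (before xs a ys (position o s)))) ext)) ,
            av ∘ embedʳ xs a ys)
    from
    where
    open Pattern p using (size)

    last = fromℕ (suc size)

    inject₁<last : ∀ s → inject₁ s Fin.< last
    inject₁<last s = Fin.≤∧≢⇒< (Fin.≤fromℕ (inject₁ s)) (≢-sym Fin.fromℕ≢inject₁)

    from : xs Avoids p × ys Avoids p -ʳ k → xs ++ a ∷ ys Avoids p -ʳ k
    from (avˡ , avʳ) o with contiguous-trichotomy c (-ʳ-init o) m
    ... | inj₁ o<m = avˡ (restrictˡ xs a ys (-ʳ-init o) o<m)
    ... | inj₂ (inj₂ m<o) = avʳ (restrictʳ xs a ys o m<)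
      where
      m< : ∀ t → m Fin.< position o t
      m< t with view t
      -- The letter playing `k` follows the first letter of the `p`-part, which exists since
      -- patterns are nonempty and is already right of the pivot.
      ... | ‵fromℕ     = Fin.<-trans (m<o zero) (increasing o (inject₁ zero) last (inject₁<last zero))
      ... | ‵inject₁ s = m<o s
    ... | inj₂ (inj₁ (s , o≡m)) = extreme-unused p π ext s (position o last)
            (λ eq → Fin.<⇒≢ (increasing o (inject₁ s) last (inject₁<last s)) (trans o≡m (sym eq)))
            (λ k>s → subst (λ j → lookup π (position o last) > lookup π j) o≡m (order o last (inject₁ s)
              (subst₂ _>_ (sym (lookup-∷ʳ-fromℕ (letters p) k)) (sym (lookup-∷ʳ-inject₁ (letters p) k s)) k>s)))
            (λ s>k → subst (λ j → lookup π j > lookup π (position o last)) o≡m (order o (inject₁ s) last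
              (subst₂ _>_ (sym (lookup-∷ʳ-inject₁ (letters p) k s)) (sym (lookup-∷ʳ-fromℕ (letters p) k)) s>k)))

-- Universal quantification distributes over conjunction, so a family can be treated one pattern at
-- a time.
avoidsAll : ∀ {ℓ} {I : Set ℓ} {w u v : Word} {p q r : I → Pattern} →
  (∀ i → w Avoids p i ⇔ (u Avoids q i × v Avoids r i)) →
  w AvoidsAll p ⇔ (u AvoidsAll q × v AvoidsAll r)
avoidsAll eqv = mk⇔
  (λ av → (λ i → proj₁ (to (eqv i) (av i))) , (λ i → proj₂ (to (eqv i) (av i))))
  (λ (avˡ , avʳ) i → from (eqv i) (avˡ i , avʳ i))
  where open Function.Bundles.Equivalence

-- Extremality of `n` and `1` in a permutation.

module _ {n : ℕ} {π : Word} (π∈𝒮 : π ∈𝒮 n) where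

  𝒮-unique : Unique π
  𝒮-unique = Permutationₛ.Unique-resp-↭ (setoid ℕ) (↭⇒↭ₛ (↭-sym π∈𝒮))
    (Unique.applyUpTo⁺₁ suc n λ i<j _ → <⇒≢ i<j ∘ suc-injective)

  𝒮-bounds : ∀ j → 1 ≤ lookup π j × lookup π j ≤ n
  𝒮-bounds j = List.lookup
    (All-resp-↭ (↭-sym π∈𝒮) (List.applyUpTo⁺₁ {P = λ x → 1 ≤ x × x ≤ n} suc n λ i<n → z<s , i<n))
    (∈-lookup j)

  -- The range of the letters gives the weak inequality; distinctness makes it strict away from `m`.
  𝒮-max : ∀ {m} → lookup π m ≡ n → ∀ j → j ≢ m → lookup π m > lookup π j
  𝒮-max {m} πm≡n j j≢m = ≤∧≢⇒< (subst (lookup π j ≤_) (sym πm≡n) (proj₂ (𝒮-bounds j)))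
    (j≢m ∘ lookup-injective 𝒮-unique j m)

  𝒮-min : ∀ {m} → lookup π m ≡ 1 → ∀ j → j ≢ m → lookup π j > lookup π m
  𝒮-min {m} πm≡1 j j≢m = ≤∧≢⇒< (subst (_≤ lookup π j) (sym πm≡1) (proj₁ (𝒮-bounds j)))
    (j≢m ∘ lookup-injective 𝒮-unique j m ∘ sym)

corollary9 : ∀ {ℓ} {I : Set ℓ} (σ : I → Pattern) → (∀ i → Contiguous (σ i)) →
    ∀ (n : ℕ) → 1 ≤ n → ∀ (π : Word) → π ∈𝒮 n →
    (∀ (k : I → ℕ) {{_ : ∀ {i} → NonZero (k i)}} → (∀ i → All (_< k i) (letters (σ i))) →
    ∀ πˡ πʳ → π ≡ πˡ ++ n ∷ πʳ →
    (π AvoidsAll (λ i → k i -ˡ σ i) ⇔ (πˡ AvoidsAll (λ i → k i -ˡ σ i) × πʳ AvoidsAll σ))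
    × (π AvoidsAll (λ i → σ i -ʳ k i) ⇔ (πˡ AvoidsAll σ × πʳ AvoidsAll (λ i → σ i -ʳ k i))))
    ×
    ((∀ i → All (_> 1) (letters (σ i))) →
    ∀ πˡ πʳ → π ≡ πˡ ++ 1 ∷ πʳ →
    (π AvoidsAll (λ i → 1 -ˡ σ i) ⇔ (πˡ AvoidsAll (λ i → 1 -ˡ σ i) × πʳ AvoidsAll σ))
    × (π AvoidsAll (λ i → σ i -ʳ 1) ⇔ (πˡ AvoidsAll σ × πʳ AvoidsAll (λ i → σ i -ʳ 1))))
corollary9 σ contiguous n _ π π∈𝒮 =
  (λ where
    k σ<k πˡ πʳ refl →
      -- Here `k i` exceeds the letters of `σ i` as `n` exceeds the other letters of `π`.
      let ext = λ i s → inj₁ (Vec.lookup⁺ (σ<k i) s , 𝒮-max π∈𝒮 (lookup-pivot πˡ n πʳ))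
      in avoidsAll (λ i → avoids-ˡ (k i) (σ i) (contiguous i) πˡ n πʳ (ext i)) ,
         avoidsAll (λ i → avoids-ʳ (k i) (σ i) (contiguous i) πˡ n πʳ (ext i))) ,
  (λ where
    σ>1 πˡ πʳ refl →
      -- Here `1` lies below the letters of `σ i` and below the other letters of `π`.
      let ext = λ i s → inj₂ (Vec.lookup⁺ (σ>1 i) s , 𝒮-min π∈𝒮 (lookup-pivot πˡ 1 πʳ))
      in avoidsAll (λ i → avoids-ˡ 1 (σ i) (contiguous i) πˡ 1 πʳ (ext i)) ,
         avoidsAll (λ i → avoids-ʳ 1 (σ i) (contiguous i) πˡ 1 πʳ (ext i)))
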